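{- There is an algorithm which, given a graph $G$ on $n$ vertices and a linear ordering of the vertices of $G$ with width $b$, computes a cube representation of $G$ in $b+1$ dimensions in $O(b\cdot n)$ time. In particular, given a bandwidth ordering of the vertices of $G$, a cube representation of $G$ in $bw+1$ dimensions is computed in $O(bw\cdot n)$ time, where $bw$ is the bandwidth of $G$.
   Context: All graphs are simple, finite and undirected. A linear ordering of a graph $G=(V,E)$ on $n$ vertices is a bijection $f:V\to\{1,\ldots,n\}$; its width is $\max_{(u,v)\in E}|f(u)-f(v)|$. The bandwidth of $G$ is the minimum possible width of a linear ordering of $G$, and a bandwidth ordering of $G$ is a linear ordering whose width equals the bandwidth of $G$. A $k$-cube is a Cartesian product $R_1\times\cdots\times R_k$ where each $R_i$ is a closed interval of the form $[a_i,a_i+1]$ on the real line. A cube representation of $G$ in $k$ dimensions is an assignment of a $k$-cube to each vertex of $G$ such that two distinct vertices are adjacent in $G$ if and only if their $k$-cubes have non-empty intersection. Equivalently, one may output $k$ maps $f_1,\ldots,f_k:V\to\mathbb{R}$ together with interval lengths $x_1,\ldots,x_k>0$ such that distinct $u,v$ are adjacent in $G$ if and only if $|f_i(u)-f_i(v)|\le x_i$ for all $1\le i\le k$ (rescaling coordinate $i$ by $1/x_i$ gives unit cubes).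
   Formalization: For width b = 0 (graphs without edges) the literal bound O(b·n) would be zero steps, which is impossible; there the time bound proved is O(n+1), while for every b ≥ 1 it is O(b·n) as stated. -}

module Defs where

open import Level using (0ℓ)
open import Data.Nat using (ℕ; suc; _+_; _*_; _∸_; _≤_; _≟_; ∣_-_∣; NonZero)
open import Data.Integer using (+_)
open import Data.Rational as ℚ using (ℚ; 1ℚ)
open import Data.Fin using (Fin; toℕ)
open import Data.List using (List; map; filter; length; lookup; allFin; cartesianProduct)
open import Data.List.Extrema.Nat using (max)
open import Data.List.Membership.Propositional using (_∈_)
open import Data.List.Relation.Unary.Unique.Propositional using (Unique)
open import Data.Product using (∃-syntax; _×_; _,_)
open import Data.Bool using (if_then_else_)
open import Function.Bundles using (_⤖_; _⇔_; Bijection)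
open import Relation.Binary using (Rel; Symmetric; Irreflexive; Decidable)
open import Relation.Binary.PropositionalEquality using (_≡_; _≢_)
open import Relation.Nullary using (does)

------------------------------------------------------------------------
-- Graphs and linear orderings

record Graph (n : ℕ) : Set₁ where
  field
    _~_    : Rel (Fin n) 0ℓ
    sym    : Symmetric _~_
    irrefl : Irreflexive _≡_ _~_
    _~?_   : Decidable _~_

-- Positions are numbered 0,…,n-1 instead of 1,…,n; differences of positions
-- are not affected.
LinearOrdering : ℕ → Set
LinearOrdering n = Fin n ⤖ Fin n

position : ∀ {n} → LinearOrdering n → Fin n → ℕ
position f v = toℕ (Bijection.to f v)

edges : ∀ {n} → Graph n → List (Fin n × Fin n)
edges {n} G = filter (λ (u , v) → u ~? v) (cartesianProduct (allFin n) (allFin n))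
  where open Graph G

-- A graph without edges has width 0.
width : ∀ {n} → Graph n → LinearOrdering n → ℕ
width G f = max 0 (map (λ (u , v) → ∣ position f u - position f v ∣) (edges G))

IsBandwidth : ∀ {n} → Graph n → ℕ → Set
IsBandwidth {n} G bw =
  (∃[ f ] width G f ≡ bw) × ((f : LinearOrdering n) → bw ≤ width G f)

------------------------------------------------------------------------
-- Cubes

-- The k-cube [a₁,a₁+1] × ⋯ × [aₖ,aₖ+1] is given by its corner (a₁,…,aₖ).
-- Corners are rational.  Two such cubes that share a real point also share a
-- rational one (in each coordinate, the larger of the two left endpoints), so
-- a representation in this sense is a representation over the reals.
Cube : ℕ → Set
Cube k = Fin k → ℚ

_∈ᶜ_ : ∀ {k} → (Fin k → ℚ) → Cube k → Set
p ∈ᶜ a = ∀ i → a i ℚ.≤ p i × p i ℚ.≤ a i ℚ.+ 1ℚ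

Intersect : ∀ {k} → Cube k → Cube k → Set
Intersect a a′ = ∃[ p ] p ∈ᶜ a × p ∈ᶜ a′

IsCubeRepresentation : ∀ {n} → Graph n → (k : ℕ) → (Fin n → Cube k) → Set
IsCubeRepresentation G k cube =
  ∀ u v → u ≢ v → u ~ v ⇔ Intersect (cube u) (cube v)
  where open Graph G

------------------------------------------------------------------------
-- Unit-cost random access machine

-- The memory consists of registers and arrays of natural numbers.  A program
-- names finitely many of them, but array indices are computed at run time.
record State : Set where
  constructor ⟪_,_⟫
  field
    reg : ℕ → ℕ
    arr : ℕ → ℕ → ℕ

open State public

update : ∀ {A : Set} → (ℕ → A) → ℕ → A → ℕ → A
update f x a y = if does (x ≟ y) then a else f y

infixl 6 _⊕_ _⊖_

data Expr : Set where
  const   : ℕ → Expr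
  var     : ℕ → Expr
  _⊕_ _⊖_ : Expr → Expr → Expr
  _[_]    : ℕ → Expr → Expr

infixr 1 _﹔_
infix  2 _≔_ _[_]≔_

data Program : Set where
  skip          : Program
  _≔_           : ℕ → Expr → Program
  _[_]≔_        : ℕ → Expr → Expr → Program
  _﹔_           : Program → Program → Program
  if_then_else′_ : Expr → Program → Program → Program
  while_loop_   : Expr → Program → Program

-- ⊖ is truncated subtraction.
⟦_⟧ : Expr → State → ℕ
⟦ const k ⟧ σ = k
⟦ var x   ⟧ σ = reg σ x
⟦ e ⊕ e′  ⟧ σ = ⟦ e ⟧ σ + ⟦ e′ ⟧ σ
⟦ e ⊖ e′  ⟧ σ = ⟦ e ⟧ σ ∸ ⟦ e′ ⟧ σ
⟦ a [ e ] ⟧ σ = arr σ a (⟦ e ⟧ σ)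

-- Every constant, memory access and arithmetic operation takes one step.
cost : Expr → ℕ
cost (const k) = 1
cost (var x)   = 1
cost (e ⊕ e′)  = 1 + cost e + cost e′
cost (e ⊖ e′)  = 1 + cost e + cost e′
cost (a [ e ]) = 1 + cost e

setReg : State → ℕ → ℕ → State
setReg ⟪ r , m ⟫ x k = ⟪ update r x k , m ⟫

setArr : State → ℕ → ℕ → ℕ → State
setArr ⟪ r , m ⟫ a j k = ⟪ r , update m a (update (m a) j k) ⟫

-- ⟨ P , σ ⟩⇓[ t ] σ′ : P started in σ halts in σ′ after exactly t steps.
-- A condition holds when its value is nonzero.
data ⟨_,_⟩⇓[_]_ : Program → State → ℕ → State → Set where

  ⇓skip : ∀ {σ} → ⟨ skip , σ ⟩⇓[ 1 ] σ

  ⇓reg : ∀ {σ x e} →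
    ⟨ x ≔ e , σ ⟩⇓[ 1 + cost e ] setReg σ x (⟦ e ⟧ σ)

  ⇓arr : ∀ {σ a i e} →
    ⟨ a [ i ]≔ e , σ ⟩⇓[ 1 + cost i + cost e ] setArr σ a (⟦ i ⟧ σ) (⟦ e ⟧ σ)

  ⇓seq : ∀ {σ σ₁ σ₂ P Q s t} →
    ⟨ P , σ ⟩⇓[ s ] σ₁ → ⟨ Q , σ₁ ⟩⇓[ t ] σ₂ →
    ⟨ P ﹔ Q , σ ⟩⇓[ s + t ] σ₂

  ⇓then : ∀ {σ σ′ e P Q t} → ⟦ e ⟧ σ ≢ 0 →
    ⟨ P , σ ⟩⇓[ t ] σ′ →
    ⟨ if e then P else′ Q , σ ⟩⇓[ 1 + cost e + t ] σ′

  ⇓else : ∀ {σ σ′ e P Q t} → ⟦ e ⟧ σ ≡ 0 →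
    ⟨ Q , σ ⟩⇓[ t ] σ′ →
    ⟨ if e then P else′ Q , σ ⟩⇓[ 1 + cost e + t ] σ′

  ⇓done : ∀ {σ e P} → ⟦ e ⟧ σ ≡ 0 →
    ⟨ while e loop P , σ ⟩⇓[ 1 + cost e ] σ

  ⇓loop : ∀ {σ σ₁ σ₂ e P s t} → ⟦ e ⟧ σ ≢ 0 →
    ⟨ P , σ ⟩⇓[ s ] σ₁ → ⟨ while e loop P , σ₁ ⟩⇓[ t ] σ₂ →
    ⟨ while e loop P , σ ⟩⇓[ 1 + cost e + s + t ] σ₂

------------------------------------------------------------------------
-- Input and output conventions

-- The graph is stored as adjacency lists, the neighbours of v (in any order)
-- being the contents of cells start v, …, start v + degree v - 1 of array 3.
-- The width of the ordering is not part of the input, and nothing is assumed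
-- about the rest of the memory.
record Input {n} (G : Graph n) (f : LinearOrdering n) (σ : State) : Set where
  open Graph G
  field
    order      : reg σ 0 ≡ n
    positions  : ∀ v → arr σ 0 (toℕ v) ≡ position f v
    nbrs       : Fin n → List (Fin n)
    unique     : ∀ v → Unique (nbrs v)
    adjacent   : ∀ u v → v ∈ nbrs u ⇔ u ~ v
    degree     : ∀ v → arr σ 2 (toℕ v) ≡ length (nbrs v)
    neighbours : ∀ v (j : Fin (length (nbrs v))) →
                 arr σ 3 (arr σ 1 (toℕ v) + toℕ j) ≡ toℕ (lookup (nbrs v) j)

-- Array 4 holds the interval lengths x₀,…,xₖ₋₁ and array 5 the k maps fᵢ, one
-- after the other.  Dividing coordinate i by xᵢ gives unit cubes.
record Output {n} (G : Graph n) (k : ℕ) (σ : State) : Set where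
  x : Fin k → ℕ
  x i = arr σ 4 (toℕ i)

  fᵢ : Fin k → Fin n → ℕ
  fᵢ i v = arr σ 5 (toℕ i * n + toℕ v)

  field
    dimension : reg σ 1 ≡ k
    positive  : ∀ i → NonZero (x i)
    correct   : IsCubeRepresentation G k
                  (λ v i → ℚ._/_ (+ fᵢ i v) (x i) {{positive i}})

-- Running time O(b·n) with constant C.  For b = 0 the product b·n vanishes,
-- while the n intervals still have to be written; there the bound is linear.
TimeBound : (C b n t : ℕ) → Set
TimeBound C b n t = (1 ≤ b → t ≤ C * (b * n)) × (b ≡ 0 → t ≤ C * suc n)

ComputesCubeRepresentation :
  ∀ {n} → Program → (C : ℕ) → Graph n → LinearOrdering n → (b : ℕ) → Set
ComputesCubeRepresentation {n} P C G f b =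
  ∀ σ → Input G f σ →
  ∃[ t ] ∃[ σ′ ] ⟨ P , σ ⟩⇓[ t ] σ′ × Output G (b + 1) σ′ × TimeBound C b n t

{-# OPTIONS --safe #-}
module Submission where

-- Write p(v) for the position of v and b for the width.  Coordinate 0 maps v
-- to 2n·p(v) if v is adjacent to the vertex at position p(v) - b, and to
-- 2n·p(v) + 2p(v) otherwise; its interval length is 2nb + 1.  It separates all
-- pairs more than b apart, and exactly the nonadjacent ones among the pairs b
-- apart.  Coordinate i + 1, for i < b, has interval length 2b and takes care of
-- the landmarks, the vertices at positions ≡ i (mod b).  It maps a landmark to
-- p(v), and any other v to p(v) + b or p(v) + 2b, according as v is adjacent to
-- the last landmark before it or not.  Thus a landmark is separated from the
-- nonadjacent vertices among its b - 1 successors, while vertices at most b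
-- apart are separated in no other case.

open import Defs
open import Data.Fin using (Fin; toℕ; fromℕ<)
open import Data.Fin.Properties using (toℕ<n; toℕ-injective; toℕ-fromℕ<; injective⇒≤)
import Data.Integer as ℤ
import Data.Integer.Properties as ℤ
open import Data.List using (List; _∷_; length; lookup; map; allFin; cartesianProduct)
open import Data.List.Extrema.Nat using (xs≤max; max≤v⁺)
open import Data.List.Membership.Propositional using (_∈_)
open import Data.List.Membership.Propositional.Properties
open import Data.List.Relation.Unary.All as All using ()
open import Data.List.Relation.Unary.AllPairs using (_∷_)
open import Data.List.Relation.Unary.Any using (index)
open import Data.List.Relation.Unary.Any.Properties using (lookup-index)
open import Data.List.Relation.Unary.Unique.Propositional using (Unique)
open import Data.Nat
open import Data.Nat.Properties
open import Data.Nat.Solver using (module +-*-Solver)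
open import Data.Product using (Σ-syntax; ∃-syntax; _×_; _,_; proj₁; proj₂; swap)
open import Data.Rational as ℚ using (ℚ; 1ℚ)
import Data.Rational.Properties as ℚ
open import Data.Rational.Unnormalised as ℚᵘ using (mkℚᵘ; 1ℚᵘ; *≡*; *≤*)
import Data.Rational.Unnormalised.Properties as ℚᵘ
open import Data.Sum using (_⊎_; inj₁; inj₂)
open import Data.Unit using (tt)
open import Function.Bundles using (_⇔_; mk⇔; Bijection; Equivalence)
open import Relation.Binary.Definitions using (Tri; tri<; tri≈; tri>)
open import Relation.Binary.PropositionalEquality hiding ([_])
import Relation.Binary.Reasoning.Setoid as SetoidReasoning
open import Relation.Nullary using (¬_; Dec; yes; no; contradiction)
open import Relation.Nullary.Decidable using (dec-true; dec-false; decidable-stable)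
open +-*-Solver using (solve; _:=_; _:+_; _:*_; con)

-- Total correctness with time bounds

-- The semantics fixes an exact time. A separate upper bound lets the two arms of a conditional, or
-- all passes of a loop, share one `T`.
record Runs (P : Program) (σ : State) (T : ℕ) (Q : State → Set) : Set where
  constructor runs
  field
    {time}  : ℕ
    {final} : State
    halts   : ⟨ P , σ ⟩⇓[ time ] final
    within  : time ≤ T
    post    : Q final

infixr 1 _>>=_

_>>=_ : ∀ {P P′ σ S T R Q} → Runs P σ S R → (∀ {τ} → R τ → Runs P′ τ T Q) →
        Runs (P ﹔ P′) σ (S + T) Q
runs h₁ s≤S r >>= k with runs h₂ t≤T q ← k r = runs (⇓seq h₁ h₂) (+-mono-≤ s≤S t≤T) q

relax : ∀ {P σ S T Q} → S ≤ T → Runs P σ S Q → Runs P σ T Q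
relax S≤T (runs h t≤S q) = runs h (≤-trans t≤S S≤T) q

weaken : ∀ {P σ T Q R} → (∀ {τ} → Q τ → R τ) → Runs P σ T Q → Runs P σ T R
weaken f (runs h t≤T q) = runs h t≤T (f q)

skips : ∀ {σ Q} → Q σ → Runs skip σ 1 Q
skips = runs ⇓skip ≤-refl

assign : ∀ {σ x e k Q} → ⟦ e ⟧ σ ≡ k → Q (setReg σ x k) → Runs (x ≔ e) σ (1 + cost e) Q
assign refl = runs ⇓reg ≤-refl

store : ∀ {σ a i e j k Q} → ⟦ i ⟧ σ ≡ j → ⟦ e ⟧ σ ≡ k → Q (setArr σ a j k) →
        Runs (a [ i ]≔ e) σ (1 + cost i + cost e) Q
store refl refl = runs ⇓arr ≤-refl

-- Unlike `_>>=_`, this keeps the updated state explicit: later reads at literal indices reduce by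
-- computation, and no intermediate assertion is needed.
assign-then : ∀ {P σ x e k T Q} → ⟦ e ⟧ σ ≡ k → Runs P (setReg σ x k) T Q →
              Runs (x ≔ e ﹔ P) σ (1 + cost e + T) Q
assign-then refl (runs h t≤T q) = runs (⇓seq ⇓reg h) (+-monoʳ-≤ _ t≤T) q

store-then : ∀ {P σ a i e j k T Q} → ⟦ i ⟧ σ ≡ j → ⟦ e ⟧ σ ≡ k →
             Runs P (setArr σ a j k) T Q →
             Runs (a [ i ]≔ e ﹔ P) σ (1 + cost i + cost e + T) Q
store-then refl refl (runs h t≤T q) = runs (⇓seq ⇓arr h) (+-monoʳ-≤ _ t≤T) q

branch : ∀ {σ e P P′ T Q} →
         (⟦ e ⟧ σ ≢ 0 → Runs P σ T Q) → (⟦ e ⟧ σ ≡ 0 → Runs P′ σ T Q) →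
         Runs (if e then P else′ P′) σ (1 + cost e + T) Q
branch {σ} {e} yes! no! with ⟦ e ⟧ σ ≟ 0
... | yes e≡0 with runs h t≤T q ← no! e≡0 = runs (⇓else e≡0 h) (+-monoʳ-≤ (1 + cost e) t≤T) q
... | no e≢0 with runs h t≤T q ← yes! e≢0 = runs (⇓then e≢0 h) (+-monoʳ-≤ (1 + cost e) t≤T) q

iterate : ∀ {σ e P S T R Q} → ⟦ e ⟧ σ ≢ 0 → Runs P σ S R →
          (∀ {τ} → R τ → Runs (while e loop P) τ T Q) →
          Runs (while e loop P) σ (1 + cost e + S + T) Q
iterate {e = e} e≢0 (runs h s≤S r) k with runs h′ t≤T q ← k r =
  runs (⇓loop e≢0 h h′) (+-mono-≤ (+-monoʳ-≤ (1 + cost e) s≤S) t≤T) q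

update-same : ∀ {A : Set} (f : ℕ → A) x a → update f x a x ≡ a
update-same f x a rewrite dec-true (x ≟ x) refl = refl

update-other : ∀ {A : Set} (f : ℕ → A) {x y} a → x ≢ y → update f x a y ≡ f y
update-other f {x} {y} a x≢y rewrite dec-false (x ≟ y) x≢y = refl

-- The language has no comparison, but the truncated difference is nonzero precisely while the
-- counter is below `e`. As `e` is evaluated afresh before each pass, its value has to follow from
-- the invariant.
for : ℕ → Expr → Program → Program
for c e P = c ≔ const 0 ﹔ while e ⊖ var c loop (P ﹔ c ≔ var c ⊕ const 1)

module _ {c : ℕ} {e : Expr} {P : Program} {N T : ℕ} (Inv : ℕ → State → Set)
  (cost-e≤2 : cost e ≤ 2)
  (bound : ∀ {i σ} → Inv i σ → ⟦ e ⟧ σ ≡ N)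
  (body  : ∀ {i σ} → i < N → reg σ c ≡ i → Inv i σ →
           Runs P σ T (λ τ → reg τ c ≡ i × Inv (suc i) (setReg τ c (suc i))))
  where

  private
    -- A test costs at most 5 steps, an increment 4.
    k = 1 + cost (e ⊖ var c)

    At : ℕ → State → Set
    At i σ = reg σ c ≡ i × Inv i σ

    test : ∀ {i σ} → reg σ c ≡ i → Inv i σ → ⟦ e ⊖ var c ⟧ σ ≡ N ∸ i
    test c≡i inv = cong₂ _∸_ (bound inv) c≡i

    -- Induction on the number `d` of passes that are left.
    while-runs : ∀ d {i σ} → i + d ≡ N → reg σ c ≡ i → Inv i σ →
                 Runs (while e ⊖ var c loop (P ﹔ c ≔ var c ⊕ const 1)) σ
                      (d * (k + (T + 4)) + k) (Inv N)
    while-runs zero {i} {σ} i+0≡N c≡i inv =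
      runs (⇓done (trans (test c≡i inv) (m≤n⇒m∸n≡0 (≤-reflexive (sym i≡N))))) ≤-refl
           (subst (λ j → Inv j σ) i≡N inv)
      where
      i≡N : i ≡ N
      i≡N = trans (sym (+-identityʳ i)) i+0≡N
    while-runs (suc d) {i} {σ} i+d≡N c≡i inv =
      relax (≤-reflexive (sym (+-assoc (k + (T + 4)) (d * (k + (T + 4))) k)))
        (iterate (λ test≡0 → m>n⇒m∸n≢0 i<N (trans (sym (test c≡i inv)) test≡0))
          (body i<N c≡i inv >>= λ {τ} (c≡i′ , inv′) →
           assign {Q = At (suc i)} (trans (cong (_+ 1) c≡i′) (+-comm i 1))
                  (update-same (reg τ) c (suc i) , inv′))
          (λ (c≡1+i , inv′) → while-runs d (trans (sym (+-suc i d)) i+d≡N) c≡1+i inv′))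
      where
      i<N : i < N
      i<N = ≤-trans (m≤m+n (suc i) d) (≤-reflexive (trans (sym (+-suc i d)) i+d≡N))

    for-time : 2 + (N * (k + (T + 4)) + k) ≤ suc N * (T + 9)
    for-time = begin
      2 + (N * (k + (T + 4)) + k)    ≡⟨ cong (2 +_) (+-comm (N * (k + (T + 4))) k) ⟩
      (2 + k) + N * (k + (T + 4))    ≤⟨ +-mono-≤ 2+k≤ (*-monoʳ-≤ N step≤) ⟩
      (T + 9) + N * (T + 9)          ∎
      where
      open ≤-Reasoning
      k≤5 : k ≤ 5
      k≤5 = +-monoʳ-≤ 2 (+-monoˡ-≤ 1 cost-e≤2)
      2+k≤ : 2 + k ≤ T + 9
      2+k≤ = ≤-trans (+-monoʳ-≤ 2 k≤5) (≤-trans (m≤n+m 7 (T + 2)) (≤-reflexive (+-assoc T 2 7)))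
      step≤ : k + (T + 4) ≤ T + 9
      step≤ = ≤-trans (+-monoˡ-≤ (T + 4) k≤5) (≤-reflexive (trans (+-comm 5 (T + 4)) (+-assoc T 4 5)))

  -- A pass with its test and increment takes at most 5 + T + 4 steps. The initial assignment and
  -- the final failing test take at most 7, which is paid for by one more share of T + 9.
  for-runs : ∀ {σ} → Inv 0 (setReg σ c 0) → Runs (for c e P) σ (suc N * (T + 9)) (Inv N)
  for-runs {σ} inv = relax for-time
    (assign {Q = At 0} refl (update-same (reg σ) c 0 , inv) >>=
     λ (c≡0 , inv′) → while-runs N refl c≡0 inv′)

-- The program

-- Register 1 holds b, register 2 a vertex, position or coordinate and register 4, while
-- the maps are written, the position of the vertex in register 2.

-- Register 1 accumulates the maximum: m + (d ∸ m) = m ⊔ d.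
vertexWidth : Program
vertexWidth =
  for 3 (2 [ var 2 ])
    (1 ≔ var 1 ⊕ ((0 [ var 2 ] ⊖ 0 [ 3 [ 1 [ var 2 ] ⊕ var 3 ] ]) ⊖ var 1))

computeWidth : Program
computeWidth =
  1 ≔ const 0 ﹔
  for 2 (var 0) vertexWidth

-- For every position p, array 6 receives the address of row 1 + p mod b of
-- array 5, and array 7 receives 2np.
tabulate : Program
tabulate =
  4 ≔ var 0 ﹔
  5 ≔ const 0 ﹔
  6 ≔ const 0 ﹔
  for 2 (var 0)
    (6 [ var 2 ]≔ var 4 ﹔
     7 [ var 2 ]≔ var 6 ﹔
     6 ≔ var 6 ⊕ (var 0 ⊕ var 0) ﹔
     5 ≔ var 5 ⊕ const 1 ﹔
     4 ≔ var 4 ⊕ var 0 ﹔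
     if var 1 ⊖ var 5 then skip else′ (4 ≔ var 0 ﹔ 5 ≔ const 0))

-- For want of multiplication, the length 2nb + 1 of row 0 is accumulated in register 4 by the loop
-- that writes the other lengths, and is stored last.
writeIntervals : Program
writeIntervals =
  4 ≔ const 1 ﹔
  for 2 (var 1)
    (4 ≔ var 4 ⊕ (var 0 ⊕ var 0) ﹔
     4 [ var 2 ⊕ const 1 ]≔ var 1 ⊕ var 1) ﹔
  4 [ const 0 ]≔ var 4

-- Writes the values that are right as long as no neighbour is taken into account. Register 5, which
-- starts at the vertex, walks down the column in steps of `n`.
fillColumn : Program
fillColumn =
  5 [ var 2 ]≔ 7 [ var 4 ] ⊕ (var 4 ⊕ var 4) ﹔
  for 3 (var 1)
    (5 ≔ var 5 ⊕ var 0 ﹔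
     5 [ var 5 ]≔ var 4 ⊕ (var 1 ⊕ var 1))

-- Only earlier neighbours matter: one fewer than `b` positions back lowers the row of its own
-- residue, one `b` positions back lowers row 0. As each neighbour touches a single cell, the scan
-- costs O(degree) and not O(b · degree).
lowerColumn : Program
lowerColumn =
  for 3 (2 [ var 2 ])
    (5 ≔ 0 [ 3 [ 1 [ var 2 ] ⊕ var 3 ] ] ﹔
     if var 4 ⊖ var 5
     then if var 1 ⊖ (var 4 ⊖ var 5)
          then 5 [ 6 [ var 5 ] ⊕ var 2 ]≔ var 4 ⊕ var 1
          else′ (5 [ var 2 ]≔ 7 [ var 4 ])
     else′ skip)

writeMaps : Program
writeMaps =
  for 2 (var 0)
    (4 ≔ 0 [ var 2 ] ﹔
     5 ≔ var 2 ﹔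
     fillColumn ﹔
     lowerColumn ﹔
     -- The vertex is a landmark in this row. For `b = 0` the store goes to row 1, outside the only
     -- coordinate of the output.
     5 [ 6 [ var 4 ] ⊕ var 2 ]≔ var 4)

cubeRepresentation : Program
cubeRepresentation =
  computeWidth ﹔
  tabulate ﹔
  writeIntervals ﹔
  writeMaps ﹔
  1 ≔ var 1 ⊕ const 1

-- Maxima, addresses and residues

m+[n∸m]≡m⊔n : ∀ m n → m + (n ∸ m) ≡ m ⊔ n
m+[n∸m]≡m⊔n m n with ≤-total m n
... | inj₁ m≤n = trans (m+[n∸m]≡n m≤n) (sym (m≤n⇒m⊔n≡n m≤n))
... | inj₂ n≤m = trans (cong (m +_) (m≤n⇒m∸n≡0 n≤m)) (trans (+-identityʳ m) (sym (m≥n⇒m⊔n≡m n≤m)))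

-- Uniqueness of quotient and remainder. It tells the cells of array 5 apart and, with `b` in place
-- of `n`, identifies residues.
address-injective : ∀ {n i j v w} → v < n → w < n → i * n + v ≡ j * n + w → i ≡ j × v ≡ w
address-injective {n} {zero} {zero} _ _ eq = refl , eq
address-injective {n} {zero} {suc j} {v} {w} v<n _ eq =
  contradiction v<n (≤⇒≯ (≤-trans (m≤m+n n (j * n + w)) (≤-reflexive (trans (sym (+-assoc n _ w)) (sym eq)))))
address-injective {n} {suc i} {zero} {v} {w} _ w<n eq =
  contradiction w<n (≤⇒≯ (≤-trans (m≤m+n n (i * n + v)) (≤-reflexive (trans (sym (+-assoc n _ v)) eq))))
address-injective {n} {suc i} {suc j} {v} {w} v<n w<n eq
  with refl , v≡w ← address-injective {n} {i} {j} v<n w<n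
         (+-cancelˡ-≡ n _ _ (trans (sym (+-assoc n _ v)) (trans eq (+-assoc n _ w)))) = refl , v≡w

-- Steps a residue just as `tabulate` steps register 5, with the same truncated difference as test.
next : ℕ → ℕ → ℕ
next b r with b ∸ suc r
... | zero  = 0
... | suc _ = suc r

-- The residue of p modulo b; junk value rem 0 p = 0.
rem : ℕ → ℕ → ℕ
rem b zero    = 0
rem b (suc p) = next b (rem b p)

next-wraps : ∀ b r → b ∸ suc r ≡ 0 → next b r ≡ 0
next-wraps b r eq with b ∸ suc r
next-wraps b r eq | zero = refl

next-increments : ∀ b r → b ∸ suc r ≢ 0 → next b r ≡ suc r
next-increments b r neq with b ∸ suc r
... | zero  = contradiction refl neq
... | suc _ = refl

-- Verification of the program from numerical facts about its input

module Layout (σ : State) where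

  pos deg : ℕ → ℕ
  pos = arr σ 0
  deg = arr σ 2

  nb : ℕ → ℕ → ℕ
  nb v j = pos (arr σ 3 (arr σ 1 v + j))

  -- Truncation discards later neighbours; their edges are accounted for at the other end.
  Bounded : ℕ → ℕ → ℕ → Set
  Bounded v d m = ∀ {k} → k < d → pos v ∸ nb v k ≤ m

-- The graph enters only through these facts. Together `width≤b` and `b-least` make `b` the maximum
-- that `computeWidth` finds, and `deg≤` keeps each scan of neighbours within O(b + 1).
module Verification
  (n b : ℕ) (σ₀ : State)
  (order   : reg σ₀ 0 ≡ n)
  (pos<n   : ∀ {v} → v < n → Layout.pos σ₀ v < n)
  (nb<n    : ∀ {v j} → v < n → j < Layout.deg σ₀ v → Layout.nb σ₀ v j < n)
  (width≤b : ∀ {v} → v < n → Layout.Bounded σ₀ v (Layout.deg σ₀ v) b)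
  (b-least : ∀ {m} → (∀ {v} → v < n → Layout.Bounded σ₀ v (Layout.deg σ₀ v) m) → b ≤ m)
  (deg≤    : ∀ {v} → v < n → Layout.deg σ₀ v ≤ suc (b + b))
  where

  open Layout σ₀

  -- Equality of whole arrays is maintained for free: the program stores only in arrays 4 to 7, and
  -- an update at another literal index reduces away.
  Frame : State → Set
  Frame σ = reg σ 0 ≡ n × arr σ 0 ≡ arr σ₀ 0 × arr σ 1 ≡ arr σ₀ 1 ×
            arr σ 2 ≡ arr σ₀ 2 × arr σ 3 ≡ arr σ₀ 3

  pos-eval : ∀ {σ v} → Frame σ → reg σ 2 ≡ v → arr σ 0 (reg σ 2) ≡ pos v
  pos-eval (_ , e₀ , _) refl = cong-app e₀ _

  deg-eval : ∀ {σ v} → Frame σ → reg σ 2 ≡ v → arr σ 2 (reg σ 2) ≡ deg v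
  deg-eval (_ , _ , _ , e₂ , _) refl = cong-app e₂ _

  nb-eval : ∀ {σ v j} → Frame σ → reg σ 2 ≡ v → reg σ 3 ≡ j →
            arr σ 0 (arr σ 3 (arr σ 1 (reg σ 2) + reg σ 3)) ≡ nb v j
  nb-eval (_ , e₀ , e₁ , _ , e₃) refl refl rewrite e₀ | e₁ | e₃ = refl

  suc-deg≤ : ∀ {v} → v < n → suc (deg v) ≤ 2 * suc b
  suc-deg≤ v<n = ≤-trans (s≤s (deg≤ v<n)) (≤-reflexive (cong suc
    (trans (sym (+-suc b b)) (cong (λ x → b + suc x) (sym (+-identityʳ b))))))

  deg-loop-time : ∀ {v} T → v < n → suc (deg v) * (T + 9) ≤ suc b * (2 * (T + 9))
  deg-loop-time {v} T v<n = begin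
    suc (deg v) * (T + 9)  ≤⟨ *-monoˡ-≤ (T + 9) (suc-deg≤ v<n) ⟩
    (2 * suc b) * (T + 9)  ≡⟨ cong (_* (T + 9)) (*-comm 2 (suc b)) ⟩
    (suc b * 2) * (T + 9)  ≡⟨ *-assoc (suc b) 2 (T + 9) ⟩
    suc b * (2 * (T + 9))  ∎
    where open ≤-Reasoning

  -- Computing the width

  WidthInv : ℕ → State → Set
  WidthInv i σ = Frame σ × reg σ 1 ≤ b × (∀ {v} → v < i → Bounded v (deg v) (reg σ 1))

  VertexWidthInv : ℕ → ℕ → State → Set
  VertexWidthInv v j σ = reg σ 2 ≡ v × WidthInv v σ × Bounded v j (reg σ 1)

  extend-below : ∀ {P : ℕ → Set} {i} → (∀ {k} → k < i → P k) → P i → ∀ {k} → k < suc i → P k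
  extend-below below at k<1+i with m<1+n⇒m<n∨m≡n k<1+i
  ... | inj₁ k<i  = below k<i
  ... | inj₂ refl = at

  vertexWidth-runs : ∀ {v σ} → v < n → reg σ 2 ≡ v → WidthInv v σ →
    Runs vertexWidth σ (suc b * 80) (λ τ → reg τ 2 ≡ v × WidthInv (suc v) τ)
  vertexWidth-runs {v} v<n v≡ inv =
    relax (deg-loop-time 31 v<n)
      (weaken (λ (v≡ , (fr , m≤b , all) , cur) → v≡ , fr , m≤b , extend-below all cur)
        (for-runs (VertexWidthInv v) ≤-refl (λ {_} {σ} (v≡ , (fr , _) , _) → deg-eval {σ} fr v≡) body
          (v≡ , inv , λ ())))
    where
    body : ∀ {j σ} → j < deg v → reg σ 3 ≡ j → VertexWidthInv v j σ →
           Runs _ σ 31 (λ τ → reg τ 3 ≡ j × VertexWidthInv v (suc j) (setReg τ 3 (suc j)))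
    -- The cost of a straight-line body is a closed numeral, so its bound is decided by evaluation.
    -- The generous 31 yields the factor 2 (31 + 9) = 80 per vertex.
    body {j} {σ} j<d j≡ (v≡ , (fr , m≤b , all) , cur) = relax (≤ᵇ⇒≤ _ 31 tt) (
      assign
        (trans (cong (λ d → reg σ 1 + (d ∸ reg σ 1))
                     (cong₂ _∸_ (pos-eval {σ} fr v≡) (nb-eval {σ} fr v≡ j≡)))
               (m+[n∸m]≡m⊔n (reg σ 1) (pos v ∸ nb v j)))
        (j≡ , v≡ ,
         (fr , ⊔-lub m≤b (width≤b v<n j<d) , λ w< k< → ≤-trans (all w< k<) (m≤m⊔n _ _)) ,
         extend-below (λ k< → ≤-trans (cur k<) (m≤m⊔n _ _)) (m≤n⊔m _ _)))

  computeWidth-runs : Runs computeWidth σ₀ (2 + suc n * (suc b * 80 + 9))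
                        (λ σ → Frame σ × reg σ 1 ≡ b)
  computeWidth-runs = assign-then refl
    -- After the last vertex register 1 bounds all differences, whence `b-least` gives one
    -- inequality; the invariant has kept the other.
    (weaken (λ (fr , m≤b , all) → fr , ≤-antisym m≤b (b-least (λ v<n → all v<n)))
      (for-runs WidthInv (s≤s z≤n) (λ inv → proj₁ (proj₁ inv)) vertexWidth-runs
        ((order , refl , refl , refl , refl) , z≤n , λ ())))

  -- Row addresses, multiples of 2n and interval lengths

  Row : ℕ → ℕ
  Row p = suc (rem b p) * n

  Tables : ℕ → State → Set
  Tables i σ = ∀ {p} → p < i → arr σ 6 p ≡ Row p × arr σ 7 p ≡ p * (n + n)

  TableInv : ℕ → State → Set
  TableInv i σ = Frame σ × reg σ 1 ≡ b × Tables i σ ×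
                 reg σ 4 ≡ Row i × reg σ 5 ≡ rem b i × reg σ 6 ≡ i * (n + n)

  tabulate-runs : ∀ {σ} → Frame σ → reg σ 1 ≡ b →
    Runs tabulate σ (6 + suc n * 49) (λ τ → Frame τ × reg τ 1 ≡ b × Tables n τ)
  tabulate-runs {σ} fr b≡ =
    assign-then (trans (proj₁ fr) (sym (+-identityʳ n)))
    (assign-then refl
    (assign-then refl
    (weaken (λ (fr , b≡ , tab , _) → fr , b≡ , tab)
      (for-runs TableInv (s≤s z≤n) (λ inv → proj₁ (proj₁ inv)) body
        (fr , b≡ , (λ ()) , refl , refl , refl)))))
    where
    body : ∀ {i σ} → i < n → reg σ 2 ≡ i → TableInv i σ →
           Runs _ σ 40 (λ τ → reg τ 2 ≡ i × TableInv (suc i) (setReg τ 2 (suc i)))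
    body {i} {σ} i<n i≡ (fr , b≡ , tab , r4≡ , r5≡ , r6≡) = relax (≤ᵇ⇒≤ _ 40 tt)
      (store-then i≡ r4≡
      (store-then i≡ r6≡
      (assign-then (trans (cong₂ _+_ r6≡ (cong₂ _+_ (proj₁ fr) (proj₁ fr))) (+-comm (i * (n + n)) (n + n)))
      (assign-then (trans (cong (_+ 1) r5≡) (+-comm (rem b i) 1))
      (assign-then (trans (cong₂ _+_ r4≡ (proj₁ fr)) (+-comm (Row i) n))
      (branch
        (λ ≢0 → relax (≤ᵇ⇒≤ _ 4 tt) (skips
          let next≡ = next-increments b (rem b i) (λ ≡0 → ≢0 (trans (cong (_∸ suc (rem b i)) b≡) ≡0)) in
          (i≡ , fr , b≡ , tab′ , cong (λ r → suc r * n) (sym next≡) , sym next≡ , refl)))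
        (λ ≡0 →
          let next≡ = next-wraps b (rem b i) (trans (cong (_∸ suc (rem b i)) (sym b≡)) ≡0) in
          assign-then (trans (proj₁ fr) (trans (sym (+-identityʳ n)) (cong (λ r → suc r * n) (sym next≡))))
          (assign (sym next≡)
          (i≡ , fr , b≡ , tab′ , refl , refl , refl)))))))))
      where
      tab′ : ∀ {p} → p < suc i →
             update (arr σ 6) i (Row i) p ≡ Row p × update (arr σ 7) i (i * (n + n)) p ≡ p * (n + n)
      tab′ = extend-below
        (λ p<i → let p≢i = ≢-sym (<⇒≢ p<i) in
          trans (update-other (arr σ 6) _ p≢i) (proj₁ (tab p<i)) ,
          trans (update-other (arr σ 7) _ p≢i) (proj₂ (tab p<i)))
        (update-same (arr σ 6) i _ , update-same (arr σ 7) i _)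

  Intervals : ℕ → State → Set
  Intervals i σ = ∀ {k} → k < i → arr σ 4 (suc k) ≡ b + b

  IntervalInv : ℕ → State → Set
  IntervalInv i σ = Frame σ × reg σ 1 ≡ b × Tables n σ ×
                    reg σ 4 ≡ suc (i * (n + n)) × Intervals i σ

  Env : State → Set
  Env σ = Frame σ × reg σ 1 ≡ b × Tables n σ × arr σ 4 0 ≡ suc (b * (n + n)) × Intervals b σ

  writeIntervals-runs : ∀ {σ} → Frame σ → reg σ 1 ≡ b → Tables n σ →
    Runs writeIntervals σ (2 + (suc b * 29 + 3)) Env
  writeIntervals-runs {σ} fr b≡ tab =
    assign-then refl
    (for-runs IntervalInv (s≤s z≤n) (λ inv → proj₁ (proj₂ inv)) body (fr , b≡ , tab , refl , λ ())
      >>= λ (fr , b≡ , tab , r4≡ , ints) → store refl r4≡ (fr , b≡ , tab , refl , ints))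
    where
    body : ∀ {i σ} → i < b → reg σ 2 ≡ i → IntervalInv i σ →
           Runs _ σ 20 (λ τ → reg τ 2 ≡ i × IntervalInv (suc i) (setReg τ 2 (suc i)))
    body {i} {σ} i<b i≡ (fr , b≡ , tab , r4≡ , ints) = relax (≤ᵇ⇒≤ _ 20 tt)
      (assign-then (trans (cong₂ _+_ r4≡ (cong₂ _+_ (proj₁ fr) (proj₁ fr))) (cong suc (+-comm (i * (n + n)) (n + n))))
      (store (trans (cong (_+ 1) i≡) (+-comm i 1)) (cong₂ _+_ b≡ b≡)
        (i≡ , fr , b≡ , tab , refl ,
         extend-below (λ k<i → trans (update-other (arr σ 4) _ (≢-sym (<⇒≢ (s≤s k<i)))) (ints k<i))
                      (update-same (arr σ 4) (suc i) (b + b)))))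

  -- The columns of array 5

  high low : ℕ → ℕ → ℕ
  high v zero    = pos v * (n + n) + (pos v + pos v)
  high v (suc i) = pos v + (b + b)
  low v zero     = pos v * (n + n)
  low v (suc i)  = pos v + b

  -- As p(v) - y ≤ b for neighbours, y + b ≤ p(v) means that equality holds.
  Lowers : ℕ → ℕ → ℕ → Set
  Lowers v zero    y = y < pos v × y + b ≤ pos v
  Lowers v (suc i) y = y < pos v × pos v < y + b × rem b y ≡ i

  Seen : ℕ → ℕ → ℕ → Set
  Seen v j y = ∃[ k ] k < j × nb v k ≡ y

  -- The content of row i in the column of v once j neighbours have been scanned.
  Cell : ℕ → ℕ → ℕ → ℕ → Set
  Cell v j i x = (∃[ y ] Seen v j y × Lowers v i y × x ≡ low v i)
               ⊎ ((∀ {y} → Seen v j y → ¬ Lowers v i y) × x ≡ high v i)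

  Column : (ℕ → ℕ → Set) → ℕ → (ℕ → ℕ) → Set
  Column Spec v m = ∀ {i} → i ≤ b → Spec i (m (i * n + v))

  Entry : ℕ → ℕ → ℕ → Set
  Entry v i x = (i ≡ suc (rem b (pos v)) × x ≡ pos v)
              ⊎ (i ≢ suc (rem b (pos v)) × Cell v (deg v) i x)

  Done : ℕ → (ℕ → ℕ) → Set
  Done v m = ∀ {w} → w < v → Column (Entry w) w m

  -- An address determines its column. The row `a` is unrestricted, which covers the store in row 1
  -- when `b = 0`.
  done-write : ∀ {v} m a {k} → v < n → Done v m → Done v (update m (a * n + v) k)
  done-write {v} m a v<n done {w} w<v {i} i≤b =
    subst (Entry w i) (sym (update-other m _ address≢)) (done w<v i≤b)
    where
    address≢ : a * n + v ≢ i * n + w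
    address≢ eq = <⇒≢ w<v (sym (proj₂ (address-injective {n} {a} {i} v<n (<-trans w<v v<n) eq)))

  -- There are two specifications because scanning one more neighbour changes what is claimed of
  -- every row, although only one cell is written.
  column-write : ∀ {v k} (Spec Spec′ : ℕ → ℕ → Set) m a → v < n → Column Spec v m → Spec′ a k →
                 (∀ {i x} → i ≢ a → Spec i x → Spec′ i x) → Column Spec′ v (update m (a * n + v) k)
  column-write {v} {k} Spec Spec′ m a v<n col new old {i} i≤b with i ≟ a
  ... | yes refl = subst (Spec′ a) (sym (update-same m _ k)) new
  ... | no i≢a   = subst (Spec′ i) (sym (update-other m k address≢)) (old i≢a (col i≤b))
    where
    address≢ : a * n + v ≢ i * n + v
    address≢ eq = i≢a (sym (proj₁ (address-injective {n} {a} {i} v<n v<n eq)))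

  cell-keep : ∀ {v j} i {x} → ¬ Lowers v i (nb v j) → Cell v j i x → Cell v (suc j) i x
  cell-keep _ _ (inj₁ (y , (k , k<j , ≡y) , lowers , x≡)) = inj₁ (y , (k , m≤n⇒m≤1+n k<j , ≡y) , lowers , x≡)
  cell-keep {v} {j} i ¬lowers (inj₂ (none , x≡)) = inj₂ (none′ , x≡)
    where
    none′ : ∀ {y} → Seen v (suc j) y → ¬ Lowers v i y
    none′ (k , k<1+j , refl) with m<1+n⇒m<n∨m≡n k<1+j
    ... | inj₁ k<j  = none (k , k<j , refl)
    ... | inj₂ refl = ¬lowers

  cell-lower : ∀ {v j} i → Lowers v i (nb v j) → Cell v (suc j) i (low v i)
  cell-lower {v} {j} i lowers = inj₁ (nb v j , (j , ≤-refl , refl) , lowers , refl)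

  FillInv : ℕ → ℕ → State → Set
  FillInv v i σ = reg σ 2 ≡ v × reg σ 4 ≡ pos v × Env σ × Done v (arr σ 5) ×
                  reg σ 5 ≡ i * n + v × (∀ {k} → k < suc i → arr σ 5 (k * n + v) ≡ high v k)

  LowerInv : ℕ → ℕ → State → Set
  LowerInv v j σ = reg σ 2 ≡ v × reg σ 4 ≡ pos v × Env σ × Done v (arr σ 5) ×
                   Column (Cell v j) v (arr σ 5)

  row-address : ∀ {σ v p} → Tables n σ → p < n → reg σ 2 ≡ v →
                arr σ 6 p + reg σ 2 ≡ suc (rem b p) * n + v
  row-address tab p<n v≡ = cong₂ _+_ (proj₁ (tab p<n)) v≡

  fillColumn-runs : ∀ {v σ} → v < n → reg σ 2 ≡ v → reg σ 4 ≡ pos v → reg σ 5 ≡ v →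
    Env σ → Done v (arr σ 5) → Runs fillColumn σ (8 + suc b * 29) (LowerInv v 0)
  fillColumn-runs {v} {σ} v<n v≡ p≡ a≡ env@(_ , _ , tab , _) done =
    store-then v≡
      (cong₂ _+_ (trans (cong (arr σ 7) p≡) (proj₂ (tab (pos<n v<n)))) (cong₂ _+_ p≡ p≡))
      -- Before any neighbour has been scanned nothing can lower a cell, so the second alternative
      -- of `Cell` holds in every row.
      (weaken (λ { (v≡ , p≡ , env , done , _ , filled) →
                   v≡ , p≡ , env , done , λ i≤b → inj₂ ((λ { (_ , () , _) }) , filled (s≤s i≤b)) })
        (for-runs (FillInv v) (s≤s z≤n) (λ (_ , _ , (_ , b≡ , _) , _) → b≡) body
          (v≡ , p≡ , env , done-write (arr σ 5) 0 v<n done , a≡ ,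
           -- Row 0 is written before the loop, so the invariant starts with one row filled.
           λ { {zero} (s≤s z≤n) → update-same (arr σ 5) v _ })))
    where
    body : ∀ {i σ} → i < b → reg σ 3 ≡ i → FillInv v i σ →
           Runs _ σ 20 (λ τ → reg τ 3 ≡ i × FillInv v (suc i) (setReg τ 3 (suc i)))
    body {i} {σ} i<b i≡ (v≡ , p≡ , env@(fr , b≡ , _) , done , a≡ , filled) = relax (≤ᵇ⇒≤ _ 20 tt)
      (assign-then (trans (cong₂ _+_ a≡ (proj₁ fr)) (trans (+-comm (i * n + v) n) (sym (+-assoc n (i * n) v))))
      (store refl (cong₂ _+_ p≡ (cong₂ _+_ b≡ b≡))
        (i≡ , v≡ , p≡ , env , done-write (arr σ 5) (suc i) v<n done , refl ,
         extend-below
           (λ {k} k<1+i → trans (update-other (arr σ 5) _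
             (λ eq → <⇒≢ k<1+i (sym (proj₁ (address-injective {n} {suc i} {k} v<n v<n eq))))) (filled k<1+i))
           (update-same (arr σ 5) (suc i * n + v) _))))

  -- A neighbour satisfies `Lowers` for at most one row. One store, or none for a later neighbour,
  -- therefore brings the whole column up to date, and `cell-keep` handles the other rows.
  lowerColumn-runs : ∀ {v σ} → v < n → LowerInv v 0 σ →
    Runs lowerColumn σ (suc b * 98) (LowerInv v (deg v))
  lowerColumn-runs {v} v<n inv = relax (deg-loop-time 40 v<n)
    (for-runs (LowerInv v) ≤-refl (λ {_} {σ} (v≡ , _ , (fr , _) , _) → deg-eval {σ} fr v≡) body inv)
    where
    body : ∀ {j σ} → j < deg v → reg σ 3 ≡ j → LowerInv v j σ →
           Runs _ σ 40 (λ τ → reg τ 3 ≡ j × LowerInv v (suc j) (setReg τ 3 (suc j)))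
    body {j} {σ} j<d j≡ (v≡ , p≡ , env@(fr , b≡ , tab , _) , done , col) = relax (≤ᵇ⇒≤ _ 40 tt)
      (assign-then (nb-eval {σ} fr v≡ j≡)
      (branch
        (λ p∸y≢0 → branch
          (λ b∸≢0 →
            let y<p = earlier p∸y≢0
                p<y+b = ≤-<-trans (m≤n+m∸n (pos v) y)
                          (+-monoʳ-< y (m∸n≢0⇒n<m (λ ≡0 → b∸≢0 (trans test≡ ≡0))))
            in store (row-address {σ} tab y<n v≡) (cong₂ _+_ p≡ b≡)
                 (j≡ , v≡ , p≡ , env , done-write (arr σ 5) (suc (rem b y)) v<n done ,
                  column-write (Cell v j) (Cell v (suc j)) (arr σ 5) (suc (rem b y)) v<n col
                    (cell-lower (suc (rem b y)) (y<p , p<y+b , refl))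
                    (λ {i} i≢ → cell-keep i (near-lowers-once i p<y+b i≢))))
          (λ b∸≡0 →
            let y<p = earlier p∸y≢0
                b≤p∸y = m∸n≡0⇒m≤n (trans (sym test≡) b∸≡0)
                y+b≤p = ≤-trans (+-monoʳ-≤ y b≤p∸y) (≤-reflexive (m+[n∸m]≡n (<⇒≤ y<p)))
            in relax (≤ᵇ⇒≤ _ 8 tt) (store v≡ (trans (cong (arr σ 7) p≡) (proj₂ (tab (pos<n v<n))))
                 (j≡ , v≡ , p≡ , env , done-write (arr σ 5) 0 v<n done ,
                  column-write (Cell v j) (Cell v (suc j)) (arr σ 5) 0 v<n col
                    (cell-lower 0 (y<p , y+b≤p))
                    (λ {i} i≢ → cell-keep i (far-lowers-once i y+b≤p i≢))))))
        (λ p∸y≡0 →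
            let p≤y = m∸n≡0⇒m≤n (trans (cong (_∸ y) (sym p≡)) p∸y≡0)
            in relax (≤ᵇ⇒≤ _ _ tt) (skips
                 (j≡ , v≡ , p≡ , env , done ,
                  λ {i} i≤b → cell-keep i (later-lowers-nothing i p≤y) (col i≤b))))))
      where
      y = nb v j
      y<n = nb<n v<n j<d
      test≡ : reg σ 1 ∸ (reg σ 4 ∸ y) ≡ b ∸ (pos v ∸ y)
      test≡ = cong₂ (λ b p → b ∸ (p ∸ y)) b≡ p≡
      earlier : reg σ 4 ∸ y ≢ 0 → y < pos v
      earlier ≢0 = m∸n≢0⇒n<m (λ ≡0 → ≢0 (trans (cong (_∸ y) p≡) ≡0))
      near-lowers-once : ∀ i → pos v < y + b → i ≢ suc (rem b y) → ¬ Lowers v i y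
      near-lowers-once zero    p<y+b _  (_ , y+b≤p)  = <⇒≱ p<y+b y+b≤p
      near-lowers-once (suc i) _     i≢ (_ , _ , ≡i) = i≢ (cong suc (sym ≡i))
      far-lowers-once : ∀ i → y + b ≤ pos v → i ≢ 0 → ¬ Lowers v i y
      far-lowers-once zero    _     i≢0 _               = i≢0 refl
      far-lowers-once (suc i) y+b≤p _   (_ , p<y+b , _) = <⇒≱ p<y+b y+b≤p
      later-lowers-nothing : ∀ i → pos v ≤ y → ¬ Lowers v i y
      later-lowers-nothing zero    p≤y (y<p , _) = <⇒≱ y<p p≤y
      later-lowers-nothing (suc i) p≤y (y<p , _) = <⇒≱ y<p p≤y

  MapInv : ℕ → State → Set
  MapInv v σ = Env σ × Done v (arr σ 5)

  writeMaps-runs : ∀ {σ} → Env σ → Runs writeMaps σ (suc n * (suc b * 160 + 9)) (MapInv n)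
  writeMaps-runs env = for-runs MapInv (s≤s z≤n) (λ inv → proj₁ (proj₁ (proj₁ inv))) body (env , λ ())
    where
    body : ∀ {v σ} → v < n → reg σ 2 ≡ v → MapInv v σ →
           Runs _ σ (suc b * 160) (λ τ → reg τ 2 ≡ v × MapInv (suc v) (setReg τ 2 (suc v)))
    body {v} {σ} v<n v≡ (env@(fr , _) , done) = relax time≤
      (assign-then (pos-eval {σ} fr v≡)
      (assign-then v≡
      (fillColumn-runs v<n v≡ refl refl env done
        >>= λ inv → lowerColumn-runs v<n inv
        >>= λ {τ} (v≡ , p≡ , env@(_ , _ , tab , _) , done , col) →
          let r = suc (rem b (pos v)) in
          store (trans (cong (λ p → arr τ 6 p + reg τ 2) p≡) (row-address {τ} tab (pos<n v<n) v≡)) p≡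
            (v≡ , env , extend-below (done-write (arr τ 5) r v<n done)
              (column-write (Cell v (deg v)) (Entry v) (arr τ 5) r v<n col
                (inj₁ (refl , refl)) (λ i≢ cell → inj₂ (i≢ , cell)))))))
      where
      time≤ : 3 + (2 + (8 + suc b * 29 + (suc b * 98 + 6))) ≤ suc b * 160
      time≤ = begin
        3 + (2 + (8 + suc b * 29 + (suc b * 98 + 6)))
          ≡⟨ solve 1 (λ x → con 3 :+ (con 2 :+ (con 8 :+ x :* con 29 :+ (x :* con 98 :+ con 6)))
                      := con 19 :+ x :* con 127) refl (suc b) ⟩
        19 + suc b * 127            ≤⟨ +-monoˡ-≤ (suc b * 127) (m≤m+n 19 (b * 19)) ⟩
        suc b * 19 + suc b * 127    ≡⟨ *-distribˡ-+ (suc b) 19 127 ⟨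
        suc b * 146                 ≤⟨ *-monoʳ-≤ (suc b) (≤ᵇ⇒≤ 146 160 tt) ⟩
        suc b * 160                 ∎
        where open ≤-Reasoning

  -- The whole run

  Result : State → Set
  Result σ = reg σ 1 ≡ b + 1 × arr σ 4 0 ≡ suc (b * (n + n)) ×
             (∀ {i} → i < b → arr σ 4 (suc i) ≡ b + b) ×
             (∀ {v} → v < n → Column (Entry v) v (arr σ 5))

  cubeRepresentation-runs : Runs cubeRepresentation σ₀ (suc n * suc b * 353) Result
  cubeRepresentation-runs = relax time≤
    (computeWidth-runs >>= λ (fr , b≡) →
     tabulate-runs fr b≡ >>= λ (fr , b≡ , tab) →
     writeIntervals-runs fr b≡ tab >>= λ env →
     writeMaps-runs env >>= λ ((_ , b≡ , _ , x₀≡ , ints) , done) →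
     assign (cong (_+ 1) b≡) (refl , x₀≡ , ints , done))
    where
    x = suc b
    y = suc n
    time≤ : 2 + y * (x * 80 + 9) + (6 + y * 49 + (2 + (x * 29 + 3) + (y * (x * 160 + 9) + 4))) ≤ y * x * 353
    -- Every summand is raised to a multiple of `y * x`; the coefficients add up to 17 + 67 + 29 +
    -- 240 = 353.
    time≤ = begin
      2 + y * (x * 80 + 9) + (6 + y * 49 + (2 + (x * 29 + 3) + (y * (x * 160 + 9) + 4)))
        ≡⟨ solve 2 (λ x y → con 2 :+ y :* (x :* con 80 :+ con 9) :+ (con 6 :+ y :* con 49 :+
                       (con 2 :+ (x :* con 29 :+ con 3) :+ (y :* (x :* con 160 :+ con 9) :+ con 4)))
                     := con 17 :+ (y :* con 67 :+ (x :* con 29 :+ y :* x :* con 240))) refl x y ⟩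
      17 + (y * 67 + (x * 29 + y * x * 240))
        ≤⟨ +-mono-≤ (*-monoˡ-≤ 17 {1} {y * x} (s≤s z≤n))
             (+-mono-≤ (*-monoˡ-≤ 67 (m≤m*n y x))
                       (+-monoˡ-≤ (y * x * 240) (*-monoˡ-≤ 29 (m≤n*m x y)))) ⟩
      y * x * 17 + (y * x * 67 + (y * x * 29 + y * x * 240))
        ≡⟨ solve 1 (λ z → z :* con 17 :+ (z :* con 67 :+ (z :* con 29 :+ z :* con 240))
                     := z :* con 353) refl (y * x) ⟩
      y * x * 353 ∎
      where open ≤-Reasoning

-- Cubes over ℚ from maps into ℕ

_÷_ : (m x : ℕ) .{{_ : NonZero x}} → ℚ
m ÷ x = ℤ.+ m ℚ./ x

toℚᵘ-÷ : ∀ m d → ℚ.toℚᵘ (m ÷ suc d) ℚᵘ.≃ mkℚᵘ (ℤ.+ m) d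
toℚᵘ-÷ m d = ℚ.toℚᵘ-fromℚᵘ (mkℚᵘ (ℤ.+ m) d)

toℚᵘ-÷+1 : ∀ m d → ℚ.toℚᵘ (m ÷ suc d ℚ.+ 1ℚ) ℚᵘ.≃ mkℚᵘ (ℤ.+ (m + suc d)) d
toℚᵘ-÷+1 m d = begin
  ℚ.toℚᵘ (m ÷ suc d ℚ.+ 1ℚ)          ≈⟨ ℚ.toℚᵘ-homo-+ (m ÷ suc d) 1ℚ ⟩
  ℚ.toℚᵘ (m ÷ suc d) ℚᵘ.+ 1ℚᵘ        ≈⟨ ℚᵘ.+-congˡ 1ℚᵘ (toℚᵘ-÷ m d) ⟩
  mkℚᵘ (ℤ.+ m) d ℚᵘ.+ 1ℚᵘ            ≈⟨ *≡* (cong₂ ℤ._*_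
    (cong₂ ℤ._+_ (ℤ.*-identityʳ (ℤ.+ m)) (ℤ.*-identityˡ (ℤ.+ suc d)))
    (sym (ℤ.*-identityʳ (ℤ.+ suc d)))) ⟩
  mkℚᵘ (ℤ.+ (m + suc d)) d           ∎
  where open SetoidReasoning ℚᵘ.≃-setoid

-- Normalisation of fractions hides numerators. In unnormalised form both sides have denominator
-- `x`, and adding 1 adds `x` to the numerator.
÷≤÷+1⇔ : ∀ m m′ x .{{_ : NonZero x}} → m ÷ x ℚ.≤ m′ ÷ x ℚ.+ 1ℚ ⇔ m ≤ m′ + x
÷≤÷+1⇔ m m′ (suc d) = mk⇔
  (λ le → ℤ.drop‿+≤+ (ℤ.*-cancelʳ-≤-pos (ℤ.+ m) (ℤ.+ (m′ + suc d)) (ℤ.+ suc d)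
    (ℚᵘ.drop-*≤* (ℚᵘ.≤-respʳ-≃ (toℚᵘ-÷+1 m′ d) (ℚᵘ.≤-respˡ-≃ (toℚᵘ-÷ m d)
      (ℚ.toℚᵘ-mono-≤ le))))))
  (λ le → ℚ.toℚᵘ-cancel-≤
    (ℚᵘ.≤-respʳ-≃ (ℚᵘ.≃-sym (toℚᵘ-÷+1 m′ d)) (ℚᵘ.≤-respˡ-≃ (ℚᵘ.≃-sym (toℚᵘ-÷ m d))
      (*≤* (ℤ.*-monoʳ-≤-nonNeg (ℤ.+ suc d) (ℤ.+≤+ le))))))

-- |m - m′| ≤ x in two halves: each puts one left endpoint before the right endpoint of the other
-- interval.
Within : ℕ → ℕ → ℕ → Set
Within x m m′ = m ≤ m′ + x × m′ ≤ m + x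

representation : ∀ {n k} (G : Graph n)
  (x : Fin k → ℕ) (nz : ∀ i → NonZero (x i)) (a : Fin k → Fin n → ℕ) →
  (∀ {u v} → u ≢ v → Graph._~_ G u v ⇔ (∀ i → Within (x i) (a i u) (a i v))) →
  IsCubeRepresentation G k (λ v i → ℚ._/_ (ℤ.+ a i v) (x i) {{nz i}})
representation G x nz a correct u v u≢v = mk⇔
  (λ u~v → let within = Equivalence.to (correct u≢v) u~v in
    -- The common point has the larger left endpoint in every coordinate.
    (λ i → corner i u ℚ.⊔ corner i v) ,
    (λ i → ℚ.p≤p⊔q (corner i u) (corner i v) ,
           ℚ.⊔-lub (≤next i (m≤m+n (a i u) (x i))) (≤next i (proj₂ (within i)))) ,
    (λ i → ℚ.p≤q⊔p (corner i u) (corner i v) ,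
           ℚ.⊔-lub (≤next i (proj₁ (within i))) (≤next i (m≤m+n (a i v) (x i)))))
  (λ (p , p∈u , p∈v) → Equivalence.from (correct u≢v) λ i →
    ≤next⁻¹ i (ℚ.≤-trans (proj₁ (p∈u i)) (proj₂ (p∈v i))) ,
    ≤next⁻¹ i (ℚ.≤-trans (proj₁ (p∈v i)) (proj₂ (p∈u i))))
  where
  corner : ∀ i v → ℚ
  corner i v = _÷_ (a i v) (x i) {{nz i}}

  ≤next : ∀ i {u v} → a i u ≤ a i v + x i → corner i u ℚ.≤ corner i v ℚ.+ 1ℚ
  ≤next i {u} {v} = Equivalence.from (÷≤÷+1⇔ (a i u) (a i v) (x i) {{nz i}})

  ≤next⁻¹ : ∀ i {u v} → corner i u ℚ.≤ corner i v ℚ.+ 1ℚ → a i u ≤ a i v + x i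
  ≤next⁻¹ i {u} {v} = Equivalence.to (÷≤÷+1⇔ (a i u) (a i v) (x i) {{nz i}})

-- Correctness of the maps

-- Wrapping occurs only at the largest residue `c`, where the quotient goes up by one. The modulus
-- is a successor since residues modulo 0 are junk.
rem-spec : ∀ c p → rem (suc c) p < suc c × ∃[ q ] q * suc c + rem (suc c) p ≡ p
rem-spec c zero = s≤s z≤n , 0 , refl
rem-spec c (suc p) with rem-spec c p | suc c ∸ suc (rem (suc c) p) ≟ 0
... | r<b , q , p≡ | yes ≡0 rewrite next-wraps (suc c) (rem (suc c) p) ≡0 =
  s≤s z≤n , suc q , (begin
    suc c + q * suc c + 0       ≡⟨ +-identityʳ _ ⟩
    suc c + q * suc c           ≡⟨ cong (λ r → suc r + q * suc c) (≤-antisym (m∸n≡0⇒m≤n ≡0) (s≤s⁻¹ r<b)) ⟩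
    suc (rem (suc c) p + q * suc c)  ≡⟨ cong suc (+-comm (rem (suc c) p) _) ⟩
    suc (q * suc c + rem (suc c) p)  ≡⟨ cong suc p≡ ⟩
    suc p ∎)
  where open ≡-Reasoning
... | r<b , q , p≡ | no ≢0 rewrite next-increments (suc c) (rem (suc c) p) ≢0 =
  m∸n≢0⇒n<m ≢0 , q , trans (+-suc (q * suc c) _) (cong suc p≡)

rem< : ∀ {b} → 1 ≤ b → ∀ p → rem b p < b
rem< {suc c} _ p = proj₁ (rem-spec c p)

-- Raising the quotient of `p` by one gives a division of `p + b`, and remainders are unique.
rem-+ : ∀ {b} → 1 ≤ b → ∀ p → rem b (p + b) ≡ rem b p
rem-+ {b@(suc c)} _ p with r<b , q , p≡ ← rem-spec c p | r′<b , q′ , p′≡ ← rem-spec c (p + b) =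
  proj₂ (address-injective {b} {q′} {suc q} r′<b r<b (begin
    q′ * b + rem b (p + b)  ≡⟨ p′≡ ⟩
    p + b                   ≡⟨ +-comm p b ⟩
    b + p                   ≡⟨ cong (b +_) p≡ ⟨
    b + (q * b + rem b p)   ≡⟨ +-assoc b (q * b) _ ⟨
    suc q * b + rem b p     ∎))
  where open ≡-Reasoning

-- With equal remainders the strict inequality passes to the quotients, and a larger quotient is
-- worth at least `b`. So landmarks of one row are at least `b` apart.
rem-gap : ∀ {b} → 1 ≤ b → ∀ {p p′} → rem b p ≡ rem b p′ → p < p′ → p + b ≤ p′
rem-gap {b@(suc c)} _ {p} {p′} r≡ p<p′
  with _ , q , p≡ ← rem-spec c p | _ , q′ , p′≡ ← rem-spec c p′ = begin
    p + b                     ≡⟨ +-comm p b ⟩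
    b + p                     ≡⟨ cong (b +_) p≡ ⟨
    b + (q * b + rem b p)     ≡⟨ +-assoc b (q * b) _ ⟨
    suc q * b + rem b p       ≤⟨ +-mono-≤ (*-monoˡ-≤ b q<q′) (≤-reflexive r≡) ⟩
    q′ * b + rem b p′         ≡⟨ p′≡ ⟩
    p′                        ∎
  where
  open ≤-Reasoning
  q<q′ : q < q′
  q<q′ = *-cancelʳ-< b q q′ (+-cancelʳ-< (rem b p) (q * b) (q′ * b)
    (subst₂ _<_ (sym p≡) (trans (sym p′≡) (cong (q′ * b +_) (sym r≡))) p<p′))

-- Lists of neighbours, edges and the width

lookup-injective : ∀ {A : Set} {xs : List A} → Unique xs → ∀ {i j} → lookup xs i ≡ lookup xs j → i ≡ j
lookup-injective {xs = x ∷ xs} (x∉ ∷ u) {Fin.zero} {Fin.zero} _ = refl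
lookup-injective {xs = x ∷ xs} (x∉ ∷ u) {Fin.zero} {Fin.suc j} eq = contradiction eq (All.lookup x∉ (∈-lookup j))
lookup-injective {xs = x ∷ xs} (x∉ ∷ u) {Fin.suc i} {Fin.zero} eq = contradiction (sym eq) (All.lookup x∉ (∈-lookup i))
lookup-injective {xs = x ∷ xs} (x∉ ∷ u) {Fin.suc i} {Fin.suc j} eq = cong Fin.suc (lookup-injective u eq)

position-injective : ∀ {n} (f : LinearOrdering n) {u v} → position f u ≡ position f v → u ≡ v
position-injective f eq = Bijection.injective f (toℕ-injective eq)

module _ {n} (G : Graph n) (f : LinearOrdering n) where
  open Graph G renaming (sym to ~-sym)

  edge≤width : ∀ {u v} → u ~ v → position f u ∸ position f v ≤ width G f
  edge≤width {u} {v} u~v = ≤-trans (m∸n≤∣m-n∣ (position f u) (position f v))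
    (All.lookup (xs≤max 0 (map (λ (u , v) → ∣ position f u - position f v ∣) (edges G)))
      (∈-map⁺ _ (∈-filter⁺ (λ (u , v) → u ~? v) (∈-cartesianProduct⁺ (∈-allFin u) (∈-allFin v)) u~v)))

  -- An absolute difference is one of the two truncated ones, and symmetry turns the second into the
  -- hypothesis for the reversed edge.
  width≤ : ∀ {m} → (∀ {u v} → u ~ v → position f u ∸ position f v ≤ m) → width G f ≤ m
  width≤ {m} edge≤ = max≤v⁺ z≤n (All.tabulate bound)
    where
    bound : ∀ {d} → d ∈ map (λ (u , v) → ∣ position f u - position f v ∣) (edges G) → d ≤ m
    bound d∈ with (u , v) , e∈ , refl ← ∈-map⁻ _ d∈
             with _ , u~v ← ∈-filter⁻ (λ (u , v) → u ~? v) {xs = cartesianProduct (allFin n) (allFin n)} e∈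
             with ∣m-n∣≡[m∸n]∨[n∸m] (position f u) (position f v)
    ... | inj₁ eq = ≤-trans (≤-reflexive eq) (edge≤ u~v)
    ... | inj₂ eq = ≤-trans (≤-reflexive eq) (edge≤ (~-sym u~v))

-- The stored graph provides the numerical facts

module Representation {n} (G : Graph n) (f : LinearOrdering n) (σ₀ : State) (input : Input G f σ₀) where
  open Graph G renaming (sym to ~-sym)
  open Input input

  b : ℕ
  b = width G f

  open Layout σ₀

  on-vertices : (P : ℕ → Set) → (∀ v → P (toℕ v)) → ∀ {v} → v < n → P v
  on-vertices P p v<n = subst P (toℕ-fromℕ< v<n) (p (fromℕ< v<n))

  nb-vertex : ∀ v {j} → j < deg (toℕ v) → ∃[ u ] v ~ u × nb (toℕ v) j ≡ position f u
  nb-vertex v {j} j<d = u , Equivalence.to (adjacent v u) (∈-lookup i) , (begin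
    pos (arr σ₀ 3 (arr σ₀ 1 (toℕ v) + j))      ≡⟨ cong (λ k → pos (arr σ₀ 3 (arr σ₀ 1 (toℕ v) + k))) (toℕ-fromℕ< j<l) ⟨
    pos (arr σ₀ 3 (arr σ₀ 1 (toℕ v) + toℕ i))  ≡⟨ cong pos (neighbours v i) ⟩
    pos (toℕ u)                                ≡⟨ positions u ⟩
    position f u                               ∎)
    where
    open ≡-Reasoning
    j<l = subst (j <_) (degree v) j<d
    i = fromℕ< j<l
    u = lookup (nbrs v) i

  vertex-nb : ∀ {v u} → v ~ u → ∃[ j ] j < deg (toℕ v) × nb (toℕ v) j ≡ position f u
  vertex-nb {v} {u} v~u = toℕ i , subst (toℕ i <_) (sym (degree v)) (toℕ<n i) ,
    trans (cong pos (neighbours v i)) (trans (cong (λ u → pos (toℕ u)) (sym (lookup-index u∈))) (positions u))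
    where
    u∈ = Equivalence.from (adjacent v u) v~u
    i = index u∈

  pos<n : ∀ {v} → v < n → pos v < n
  pos<n = on-vertices (λ v → pos v < n) (λ v → subst (_< n) (sym (positions v)) (toℕ<n _))

  nb<n : ∀ {v j} → v < n → j < deg v → nb v j < n
  nb<n v<n = on-vertices (λ v → ∀ {j} → j < deg v → nb v j < n)
    (λ v j<d → let (u , _ , eq) = nb-vertex v j<d in subst (_< n) (sym eq) (toℕ<n _)) v<n

  width≤b : ∀ {v} → v < n → Bounded v (deg v) b
  width≤b = on-vertices (λ v → Bounded v (deg v) b)
    (λ v j<d → let (u , v~u , eq) = nb-vertex v j<d in
      subst (_≤ b) (sym (cong₂ _∸_ (positions v) eq)) (edge≤width G f v~u))

  b-least : ∀ {m} → (∀ {v} → v < n → Bounded v (deg v) m) → b ≤ m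
  b-least {m} bounded = width≤ G f λ {v} {u} v~u →
    let (j , j<d , eq) = vertex-nb v~u in
    subst (_≤ m) (cong₂ _∸_ (positions v) eq) (bounded (toℕ<n v) j<d)

  close : ∀ {u v} → u ~ v → position f u ≤ position f v + b
  close {u} {v} u~v = ≤-trans (m≤n+m∸n (position f u) (position f v))
    (+-monoʳ-≤ (position f v) (edge≤width G f u~v))

  -- Neighbours lie at most `b` positions away on either side. Their positions relative to `v`,
  -- shifted by `b` to stay natural, are distinct numbers up to 2b. The position of `v` itself is
  -- not excluded, hence `suc`.
  deg≤ : ∀ {v} → v < n → deg v ≤ suc (b + b)
  deg≤ = on-vertices (λ v → deg v ≤ suc (b + b)) λ v →
    subst (_≤ suc (b + b)) (sym (degree v)) (injective⇒≤ (offset-injective v))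
    where
    offset : ∀ v → Fin (length (nbrs v)) → ℕ
    offset v i = position f (lookup (nbrs v) i) + b ∸ position f v

    nbr : ∀ v i → v ~ lookup (nbrs v) i
    nbr v i = Equivalence.to (adjacent v _) (∈-lookup i)

    offset< : ∀ v i → offset v i < suc (b + b)
    offset< v i = s≤s (m≤n+o⇒m∸n≤o _ (position f v) (≤-trans
      (+-monoˡ-≤ b (close (~-sym (nbr v i)))) (≤-reflexive (+-assoc (position f v) b b))))

    offset-injective : ∀ v {i j} → fromℕ< (offset< v i) ≡ fromℕ< (offset< v j) → i ≡ j
    offset-injective v {i} {j} eq = lookup-injective (unique v) (position-injective f
      (+-cancelʳ-≡ b _ _ (∸-cancelʳ-≡ (close (nbr v i)) (close (nbr v j))
        (trans (sym (toℕ-fromℕ< (offset< v i))) (trans (cong toℕ eq) (toℕ-fromℕ< (offset< v j)))))))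

  open Verification n b σ₀ order pos<n nb<n width≤b b-least deg≤ public

  -- Overlap of adjacent pairs and separation of the others

  interval : ℕ → ℕ
  interval zero    = suc (b * (n + n))
  interval (suc i) = b + b

  seen⇒vertex : ∀ {v y} → Seen (toℕ v) (deg (toℕ v)) y → ∃[ u ] v ~ u × y ≡ position f u
  seen⇒vertex {v} (j , j<d , refl) = nb-vertex v j<d

  low≤high : ∀ v i → low v i ≤ high v i
  low≤high v zero    = m≤m+n _ _
  low≤high v (suc i) = +-monoʳ-≤ (pos v) (m≤m+n b b)

  cell-bounds : ∀ {v j} i {x} → Cell v j i x → low v i ≤ x × x ≤ high v i
  cell-bounds {v} i (inj₁ (_ , _ , _ , refl)) = ≤-refl , low≤high v i
  cell-bounds {v} i (inj₂ (_ , refl))         = low≤high v i , ≤-refl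

  entry₀ : ∀ {v x} → Entry v 0 x → Cell v (deg v) 0 x
  entry₀ (inj₂ (_ , cell)) = cell

  -- The offset 2p(v) stays below the spacing 2n, so even a high value does not pass the low value
  -- of the next position.
  high₀≤ : ∀ {v} → v < n → high v 0 ≤ suc (pos v) * (n + n)
  high₀≤ {v} v<n = begin
    pos v * (n + n) + (pos v + pos v)  ≤⟨ +-monoʳ-≤ (pos v * (n + n)) (+-mono-≤ pos≤n pos≤n) ⟩
    pos v * (n + n) + (n + n)          ≡⟨ +-comm (pos v * (n + n)) (n + n) ⟩
    suc (pos v) * (n + n)              ∎
    where
    open ≤-Reasoning
    pos≤n = <⇒≤ (pos<n v<n)

  module _ {u v : ℕ} (u<n : u < n) (v<n : v < n) (u<v : pos u < pos v) where
    open ≤-Reasoning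

    -- Excludes `b = 0`, where the residues are junk.
    b-positive : pos v ≤ pos u + b → 1 ≤ b
    b-positive v≤u+b = +-cancelˡ-< (pos u) 0 b
      (≤-trans (≤-trans (≤-reflexive (cong suc (+-identityʳ (pos u)))) u<v) v≤u+b)

    -- In row 0 a distance below `b` leaves a whole step of 2n to absorb the offset of `v`. In the
    -- other rows values lie between the position and the position plus 2b; only a landmark `u`
    -- against a high `v` could fail, and there the edge has lowered `v`.
    adjacent⇒within : Seen v (deg v) (pos u) → pos v ≤ pos u + b →
      ∀ {i x y} → Entry u i x → Entry v i y → Within (interval i) x y
    adjacent⇒within seen v≤u+b {zero} {x} {y} eu ev = left , right
      where
      cu = cell-bounds 0 (entry₀ eu)
      cv = cell-bounds 0 (entry₀ ev)
      left : x ≤ y + interval 0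
      left = begin
        x                      ≤⟨ proj₂ cu ⟩
        high u 0               ≤⟨ high₀≤ u<n ⟩
        suc (pos u) * (n + n)  ≤⟨ *-monoˡ-≤ (n + n) u<v ⟩
        low v 0                ≤⟨ proj₁ cv ⟩
        y                      ≤⟨ m≤m+n y _ ⟩
        y + interval 0         ∎
      y≤ : y ≤ (pos u + b) * (n + n)
      y≤ with m≤n⇒m<n∨m≡n v≤u+b | entry₀ ev
      ... | inj₁ v<u+b | _ = ≤-trans (proj₂ cv) (≤-trans (high₀≤ v<n) (*-monoˡ-≤ (n + n) v<u+b))
      ... | inj₂ v≡u+b | inj₁ (_ , _ , _ , y≡) = ≤-reflexive (trans y≡ (cong (_* (n + n)) v≡u+b))
      -- At distance exactly `b` a high value is impossible, since the edge to `u` lowers it.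
      ... | inj₂ v≡u+b | inj₂ (none , _) = contradiction (u<v , ≤-reflexive (sym v≡u+b)) (none seen)
      right : y ≤ x + interval 0
      right = begin
        y                            ≤⟨ y≤ ⟩
        (pos u + b) * (n + n)        ≡⟨ *-distribʳ-+ (n + n) (pos u) b ⟩
        low u 0 + b * (n + n)        ≤⟨ +-mono-≤ (proj₁ cu) (n≤1+n _) ⟩
        x + interval 0               ∎
    adjacent⇒within seen v≤u+b {suc i} {x} {y} eu ev = go eu ev
      where
      2b = b + b
      u≤v = <⇒≤ u<v
      go : Entry u (suc i) x → Entry v (suc i) y → Within 2b x y
      go (inj₁ (_ , refl)) (inj₁ (_ , refl)) =
        ≤-trans u≤v (m≤m+n _ _) , ≤-trans v≤u+b (+-monoʳ-≤ (pos u) (m≤m+n b b))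
      go (inj₁ (i≡ , refl)) (inj₂ (i≢ , cell)) =
        ≤-trans u≤v (≤-trans (m≤m+n (pos v) b) (≤-trans (proj₁ (cell-bounds (suc i) cell)) (m≤m+n y 2b))) ,
        y≤ cell
        where
        -- At distance exactly `b` from the landmark `u`, `v` would be a landmark of the same row.
        v<u+b : pos v < pos u + b
        v<u+b = ≤∧≢⇒< v≤u+b λ v≡ → i≢ (trans i≡ (cong suc (sym
          (trans (cong (rem b) v≡) (rem-+ (b-positive v≤u+b) (pos u))))))
        y≤ : Cell v (deg v) (suc i) y → y ≤ pos u + 2b
        y≤ (inj₁ (_ , _ , _ , refl)) = ≤-trans (+-monoˡ-≤ b v≤u+b) (≤-reflexive (+-assoc (pos u) b b))
        y≤ (inj₂ (none , _)) = contradiction (u<v , v<u+b , suc-injective (sym i≡)) (none seen)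
      go (inj₂ (_ , cell)) (inj₁ (_ , refl)) with low≤x , x≤high ← cell-bounds (suc i) cell =
        ≤-trans x≤high (+-monoˡ-≤ 2b u≤v) , ≤-trans v≤u+b (≤-trans low≤x (m≤m+n x 2b))
      go (inj₂ (_ , cellᵤ)) (inj₂ (_ , cellᵥ))
        with low≤x , x≤high ← cell-bounds (suc i) cellᵤ | low≤y , y≤high ← cell-bounds (suc i) cellᵥ =
        ≤-trans x≤high (+-monoˡ-≤ 2b (≤-trans u≤v (≤-trans (m≤m+n (pos v) b) low≤y))) ,
        ≤-trans y≤high (+-monoˡ-≤ 2b (≤-trans v≤u+b low≤x))

    -- In the row of `u`, the entry of `v` is high unless a neighbour of the same residue lies fewer
    -- than `b` positions before `v`. By `rem-gap` the only such position is that of `u`; it also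
    -- keeps `v` from being a landmark of this row.
    near-separated : pos v < pos u + b → ¬ Seen v (deg v) (pos u) →
      ∀ {x y} → Entry u (suc (rem b (pos u))) x → Entry v (suc (rem b (pos u))) y → x + (b + b) < y
    near-separated v<u+b unseen (inj₂ (≢ , _)) _ = contradiction refl ≢
    near-separated v<u+b unseen (inj₁ _) (inj₁ (r≡ , _)) =
      contradiction (rem-gap (b-positive (<⇒≤ v<u+b)) (suc-injective r≡) u<v) (<⇒≱ v<u+b)
    near-separated v<u+b unseen (inj₁ (_ , refl)) (inj₂ (_ , inj₂ (_ , refl))) = +-monoˡ-< (b + b) u<v
    near-separated v<u+b unseen (inj₁ (_ , refl)) (inj₂ (_ , inj₁ (y , seen , (y<v , v<y+b , r≡) , _)))
      with <-cmp y (pos u)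
    ... | tri≈ _ refl _ = contradiction seen unseen
    ... | tri< y<u _ _ = contradiction
      (≤-trans (rem-gap (b-positive (<⇒≤ v<u+b)) r≡ y<u) (<⇒≤ u<v)) (<⇒≱ v<y+b)
    ... | tri> _ _ u<y = contradiction
      (≤-trans (rem-gap (b-positive (<⇒≤ v<u+b)) (sym r≡) u<y) (<⇒≤ y<v)) (<⇒≱ v<u+b)

    far-separated : pos u + b ≤ pos v → ¬ Seen v (deg v) (pos u) →
      (∀ {y} → Seen v (deg v) y → pos v ≤ y + b) →
      ∀ {x y} → Entry u 0 x → Entry v 0 y → x + suc (b * (n + n)) < y
    far-separated u+b≤v unseen near {x} {y} eu ev =
      ≤-<-trans (+-monoˡ-≤ (suc (b * (n + n))) (proj₂ (cell-bounds 0 (entry₀ eu))))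
                (beyond (m≤n⇒m<n∨m≡n u+b≤v) (entry₀ ev))
      where
      N = n + n
      p = pos u
      beyond : p + b < pos v ⊎ p + b ≡ pos v → Cell v (deg v) 0 y → high u 0 + suc (b * N) < y
      -- Beyond distance `b` at least a further 2n is gained, more than the 2p(u) + 1 to be made up.
      beyond (inj₁ u+b<v) cell = begin-strict
        p * N + (p + p) + suc (b * N)
          ≡⟨ solve 3 (λ c d p → c :+ (p :+ p) :+ (con 1 :+ d) := con 1 :+ p :+ p :+ (c :+ d))
               refl (p * N) (b * N) p ⟩
        suc p + p + (p * N + b * N)     <⟨ +-monoˡ-< (p * N + b * N) (+-mono-≤-< (pos<n u<n) (pos<n u<n)) ⟩
        N + (p * N + b * N)             ≡⟨ cong (N +_) (*-distribʳ-+ N p b) ⟨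
        suc (p + b) * N                 ≤⟨ *-monoˡ-≤ N u+b<v ⟩
        low v 0                         ≤⟨ proj₁ (cell-bounds 0 cell) ⟩
        y                               ∎
      -- By `near`, whatever lowered row 0 sits exactly `b` back, which is the place of `u`.
      beyond (inj₂ u+b≡v) (inj₁ (z , seen , (_ , z+b≤v) , _)) =
        contradiction (subst (Seen v (deg v)) z≡u seen) unseen
        where
        z≡u : z ≡ p
        z≡u = +-cancelʳ-≡ b z p (trans (≤-antisym z+b≤v (near seen)) (sym u+b≡v))
      -- Now only the offsets decide: 2p(v) ≥ 2p(u) + 2 exceeds 2p(u) + 1.
      beyond (inj₂ u+b≡v) (inj₂ (_ , refl)) = begin-strict
        p * N + (p + p) + suc (b * N)
          ≡⟨ solve 3 (λ c d p → c :+ (p :+ p) :+ (con 1 :+ d) := c :+ d :+ (con 1 :+ p :+ p))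
               refl (p * N) (b * N) p ⟩
        p * N + b * N + (suc p + p)     ≡⟨ cong (_+ (suc p + p)) (*-distribʳ-+ N p b) ⟨
        (p + b) * N + (suc p + p)       ≡⟨ cong (λ q → q * N + (suc p + p)) u+b≡v ⟩
        pos v * N + (suc p + p)         <⟨ +-monoʳ-< (pos v * N) (+-mono-≤-< u<v u<v) ⟩
        high v 0                        ∎

  module _ {σ : State} (result : Result σ) where

    interval≡ : ∀ {i} → i ≤ b → arr σ 4 i ≡ interval i
    interval≡ {zero}  _   = proj₁ (proj₂ result)
    interval≡ {suc i} i<b = proj₁ (proj₂ (proj₂ result)) i<b

    interval-nonZero : ∀ {i} → i ≤ b → NonZero (interval i)
    -- The added 1 keeps this length positive even for `b = 0`.
    interval-nonZero {zero}  _   = _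
    interval-nonZero {suc i} i<b = >-nonZero (≤-trans (≤-trans (s≤s z≤n) i<b) (m≤m+n b b))

    value : ℕ → Fin n → ℕ
    value i v = arr σ 5 (i * n + toℕ v)

    WithinAll : Fin n → Fin n → Set
    WithinAll u v = ∀ i → i ≤ b → Within (interval i) (value i u) (value i v)

    entry : ∀ v {i} → i ≤ b → Entry (toℕ v) i (value i v)
    entry v = proj₂ (proj₂ (proj₂ result)) (toℕ<n v)

    unseen : ∀ {u v} → ¬ u ~ v → ¬ Seen (toℕ v) (deg (toℕ v)) (pos (toℕ u))
    unseen {u} {v} u≁v seen =
      let w , v~w , eq = seen⇒vertex {v} seen in
      u≁v (~-sym (subst (v ~_) (position-injective f (trans (sym eq) (positions u))) v~w))

    ordered : ∀ {u v} → pos (toℕ u) < pos (toℕ v) → u ~ v ⇔ WithinAll u v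
    ordered {u} {v} u<v = mk⇔
      (λ u~v i i≤b → adjacent⇒within u<n v<n u<v (seen u~v) (near u~v) (entry u i≤b) (entry v i≤b))
      -- A nonadjacent pair is separated in the row of `u` if it is fewer than `b` apart, and in row
      -- 0 otherwise.
      (λ within → decidable-stable (u ~? v) λ u≁v → apart u≁v within (_ <? _))
      where
      u<n = toℕ<n u
      v<n = toℕ<n v

      seen : u ~ v → Seen (toℕ v) (deg (toℕ v)) (pos (toℕ u))
      seen u~v = let j , j<d , eq = vertex-nb (~-sym u~v) in j , j<d , trans eq (sym (positions u))

      near : u ~ v → pos (toℕ v) ≤ pos (toℕ u) + b
      near u~v = subst₂ (λ p q → p ≤ q + b) (sym (positions v)) (sym (positions u)) (close (~-sym u~v))

      near-seen : ∀ {y} → Seen (toℕ v) (deg (toℕ v)) y → pos (toℕ v) ≤ y + b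
      near-seen s = let w , v~w , y≡ = seen⇒vertex {v} s in
        subst₂ (λ p q → p ≤ q + b) (sym (positions v)) (sym y≡) (close v~w)

      apart : ¬ u ~ v → WithinAll u v → ¬ Dec (pos (toℕ v) < pos (toℕ u) + b)
      apart u≁v within (yes v<u+b) =
        let r<b = rem< (b-positive u<n v<n u<v (<⇒≤ v<u+b)) (pos (toℕ u)) in
        <⇒≱ (near-separated u<n v<n u<v v<u+b (unseen u≁v) (entry u r<b) (entry v r<b))
            (proj₂ (within _ r<b))
      apart u≁v within (no v≮u+b) =
        <⇒≱ (far-separated u<n v<n u<v (≮⇒≥ v≮u+b) (unseen u≁v) near-seen (entry u z≤n) (entry v z≤n))
            (proj₂ (within 0 z≤n))

    adjacent⇔within : ∀ {u v} → u ≢ v → u ~ v ⇔ WithinAll u v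
    adjacent⇔within {u} {v} u≢v = by-order (<-cmp (pos (toℕ u)) (pos (toℕ v)))
      where
      by-order : Tri (pos (toℕ u) < pos (toℕ v)) (pos (toℕ u) ≡ pos (toℕ v)) (pos (toℕ v) < pos (toℕ u)) →
                 u ~ v ⇔ WithinAll u v
      by-order (tri< u<v _ _) = ordered u<v
      by-order (tri≈ _ u≡v _) =
        contradiction (position-injective f (trans (sym (positions u)) (trans u≡v (positions v)))) u≢v
      by-order (tri> _ _ v<u) = mk⇔
        (λ u~v i i≤b → swap (Equivalence.to (ordered v<u) (~-sym u~v) i i≤b))
        (λ within → ~-sym (Equivalence.from (ordered v<u) (λ i i≤b → swap (within i i≤b))))

    result⇒output : Output G (b + 1) σ
    result⇒output = record
      { dimension = proj₁ result
      ; positive  = positive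
      ; correct   = representation G (λ i → arr σ 4 (toℕ i)) positive
                      (λ i v → arr σ 5 (toℕ i * n + toℕ v)) correct
      }
      where
      index≤b : (i : Fin (b + 1)) → toℕ i ≤ b
      index≤b i = s≤s⁻¹ (≤-trans (toℕ<n i) (≤-reflexive (+-comm b 1)))

      positive : (i : Fin (b + 1)) → NonZero (arr σ 4 (toℕ i))
      positive i = subst NonZero (sym (interval≡ (index≤b i))) (interval-nonZero (index≤b i))

      correct : ∀ {u v} → u ≢ v → u ~ v ⇔
        ((i : Fin (b + 1)) → Within (arr σ 4 (toℕ i)) (value (toℕ i) u) (value (toℕ i) v))
      correct {u} {v} u≢v = mk⇔
        (λ u~v i → subst (λ x → Within x (value (toℕ i) u) (value (toℕ i) v)) (sym (interval≡ (index≤b i)))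
                     (Equivalence.to (adjacent⇔within u≢v) u~v (toℕ i) (index≤b i)))
        (λ within → Equivalence.from (adjacent⇔within u≢v) λ i i≤b →
          let i<b+1 = ≤-trans (s≤s i≤b) (≤-reflexive (+-comm 1 b)) in
          subst (λ x → Within x (value i u) (value i v)) (interval≡ i≤b)
            (subst (λ i → Within (arr σ 4 i) (value i u) (value i v)) (toℕ-fromℕ< i<b+1)
              (within (fromℕ< i<b+1))))

-- The time bound

order-positive : ∀ {n} (G : Graph n) f → 1 ≤ width G f → 1 ≤ n
order-positive {zero}  G f ()
order-positive {suc n} G f _ = s≤s z≤n

-- For `b ≥ 1` both successors are at most doubles, which costs a factor 4, and 1412 = 4 · 353.
linear-time : ∀ {n b t} → (1 ≤ b → 1 ≤ n) → t ≤ suc n * suc b * 353 → TimeBound 1412 b n t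
linear-time {n} {b} {t} n-positive t≤ = wide , narrow
  where
  open ≤-Reasoning
  wide : 1 ≤ b → t ≤ 1412 * (b * n)
  wide 1≤b = begin
    t                            ≤⟨ t≤ ⟩
    suc n * suc b * 353          ≤⟨ *-monoˡ-≤ 353 (*-mono-≤ (+-monoˡ-≤ n (n-positive 1≤b)) (+-monoˡ-≤ b 1≤b)) ⟩
    (n + n) * (b + b) * 353      ≡⟨ *-comm ((n + n) * (b + b)) 353 ⟩
    353 * ((n + n) * (b + b))    ≡⟨ cong (353 *_)
      (solve 2 (λ n b → (n :+ n) :* (b :+ b) := con 4 :* (b :* n)) refl n b) ⟩
    353 * (4 * (b * n))          ≡⟨ *-assoc 353 4 (b * n) ⟨
    1412 * (b * n)               ∎
  narrow : b ≡ 0 → t ≤ 1412 * suc n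
  narrow refl = begin
    t                            ≤⟨ t≤ ⟩
    suc n * 1 * 353              ≡⟨ cong (_* 353) (*-identityʳ (suc n)) ⟩
    suc n * 353                  ≤⟨ *-monoʳ-≤ (suc n) (≤ᵇ⇒≤ 353 1412 _) ⟩
    suc n * 1412                 ≡⟨ *-comm (suc n) 1412 ⟩
    1412 * suc n                 ∎

computes : ∀ n (G : Graph n) (f : LinearOrdering n) (b : ℕ) → width G f ≡ b →
           ComputesCubeRepresentation cubeRepresentation 1412 G f b
computes n G f _ refl σ input = conclude cubeRepresentation-runs
  where
  open Representation G f σ input
  conclude : Runs cubeRepresentation σ (suc n * suc b * 353) Result →
             ∃[ t ] ∃[ τ ] ⟨ cubeRepresentation , σ ⟩⇓[ t ] τ × Output G (b + 1) τ × TimeBound 1412 b n t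
  conclude (runs h t≤ result) = _ , _ , h , result⇒output result , linear-time (order-positive G f) t≤

mainTheorem2 : Σ[ P ∈ Program ] Σ[ C ∈ ℕ ]
    (∀ n (G : Graph n) (f : LinearOrdering n) (b : ℕ) →
    width G f ≡ b →
    ComputesCubeRepresentation P C G f b)
    ×
    (∀ n (G : Graph n) (f : LinearOrdering n) (bw : ℕ) →
    IsBandwidth G bw → width G f ≡ bw →
    ComputesCubeRepresentation P C G f bw)
mainTheorem2 = cubeRepresentation , 1412 , computes , λ n G f bw _ → computes n G f bw
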